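{- Let $v\ge 2$ be an integer and let $p$ be the smallest prime divisor of $v$. Then any cyclic $(v,k,\lambda)$ difference set, i.e. any $(v,k,\lambda)$ difference set in the cyclic group $\mathbb{Z}_v$, extends at least to dimension $p$.
   Context: A $(v,k,\lambda)$ difference set in an additively written group $G$ of order $v$ is a $k$-subset $D\subseteq G$ such that every $g\in G\setminus\{0\}$ can be written as $g=a-b$ with $a,b\in D$ in exactly $\lambda$ ways. An $n$-dimensional $(v,k,\lambda)$ difference set in $G$ is a $k$-subset $E\subseteq G^n$ of $n$-tuples such that for every pair of coordinates $1\le x<y\le n$ the set $\{e_x-e_y\mid e\in E\}$ is a $(v,k,\lambda)$ difference set in $G$. A $(v,k,\lambda)$ difference set $D\subseteq G$ extends to dimension $n$ if there is an $n$-dimensional $(v,k,\lambda)$ difference set $E\subseteq G^n$ and two distinct coordinates $x\ne y$ such that $D=\{e_x-e_y\mid e\in E\}$. "Extends at least to dimension $p$" means that it extends to dimension $p$ (and possibly further). -}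

module Defs where

open import Level using (Level; _⊔_; 0ℓ)
open import Algebra.Bundles using (Group; AbelianGroup)
open import Data.Nat.Base as ℕ using (ℕ)
import Data.Nat.Divisibility as ℕ
open import Data.Nat.Primality using (Prime)
open import Data.Fin.Base as Fin using (Fin)
open import Data.Integer.Base using (ℤ; +_; _+_; _-_; -_; 0ℤ)
open import Data.Integer.Properties
  using (+-assoc; +-comm; +-identityˡ; +-identityʳ; +-inverseˡ; +-inverseʳ)
open import Data.Integer.Divisibility.Signed
  using (_∣_; divides; ∣m⇒∣-m; ∣m∣n⇒∣m+n)
open import Data.Integer.Tactic.RingSolver using (solve-∀)
open import Data.List.Base using (length)
import Data.List.Membership.Setoid as Membership
import Data.List.Relation.Unary.Unique.Setoid as Uniqueness
open import Data.Product.Base using (Σ-syntax; ∃-syntax; _×_; _,_)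
open import Data.Product.Relation.Binary.Pointwise.NonDependent using (×-setoid)
open import Data.Vec.Functional using (Vector)
open import Data.Vec.Functional.Relation.Binary.Equality.Setoid using (≋-setoid)
open import Function.Bundles using (_⇔_)
open import Relation.Binary.Bundles using (Setoid)
open import Relation.Binary.PropositionalEquality
  using (_≡_; _≢_; refl; subst)
open import Relation.Nullary.Negation.Core using (¬_)
open import Relation.Unary using (Pred; U; _≐_)

private
  variable
    a c ℓ p : Level

-- "P is a subset with exactly k elements", elements being counted up to the
-- setoid equality.  Since setoid list membership respects that equality, this
-- also forces P to respect it.
HasSize : (S : Setoid a ℓ) → Pred (Setoid.Carrier S) p → ℕ → Set (a ⊔ ℓ ⊔ p)
HasSize S P k =
  ∃[ xs ] Unique xs × length xs ≡ k × (∀ x → P x ⇔ x ∈ xs)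
  where
  open Membership S using (_∈_)
  open Uniqueness S using (Unique)

module _ (G : Group c ℓ) where

  open Group G using (Carrier; _≈_; setoid) renaming (_//_ to _⊖_; ε to 𝟎)

  Representations : Pred Carrier p → Carrier → Pred (Carrier × Carrier) (p ⊔ ℓ)
  Representations D g (a , b) = D a × D b × a ⊖ b ≈ g

  record IsDifferenceSet (v k λ′ : ℕ) (D : Pred Carrier p) : Set (c ⊔ ℓ ⊔ p) where
    field
      order           : HasSize setoid (U {A = Carrier}) v
      size            : HasSize setoid D k
      representations : ∀ g → ¬ (g ≈ 𝟎) →
                        HasSize (×-setoid setoid setoid) (Representations D g) λ′

  Differences : ∀ {n} → Pred (Vector Carrier n) p → Fin n → Fin n →
                Pred Carrier (c ⊔ ℓ ⊔ p)
  Differences E x y g = ∃[ e ] E e × g ≈ e x ⊖ e y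

  record IsNDimDifferenceSet (n v k λ′ : ℕ) (E : Pred (Vector Carrier n) p) :
                             Set (c ⊔ ℓ ⊔ p) where
    field
      order       : HasSize setoid (U {A = Carrier}) v
      size        : HasSize (≋-setoid setoid n) E k
      differences : ∀ (x y : Fin n) → x Fin.< y →
                    IsDifferenceSet v k λ′ (Differences E x y)

  -- No generality is lost by fixing the level of E: every finite subset is
  -- equivalent to list membership, which lives at level c ⊔ ℓ.
  ExtendsToDimension : (n v k λ′ : ℕ) → Pred Carrier p → Set (Level.suc (c ⊔ ℓ) ⊔ p)
  ExtendsToDimension n v k λ′ D =
    Σ[ E ∈ Pred (Vector Carrier n) (c ⊔ ℓ) ]
      IsNDimDifferenceSet n v k λ′ E ×
      (∃[ x ] ∃[ y ] x ≢ y × D ≐ Differences E x y)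

-- The cyclic group ℤ_v: integers under addition, with congruence modulo v as
-- the equality (for v = 0 this would be ℤ itself).
ℤ-mod : ℕ → AbelianGroup 0ℓ 0ℓ
ℤ-mod v = record
  { Carrier = ℤ
  ; _≈_     = _≈_
  ; _∙_     = _+_
  ; ε       = 0ℤ
  ; _⁻¹     = -_
  ; isAbelianGroup = record
    { isGroup = record
      { isMonoid = record
        { isSemigroup = record
          { isMagma = record
            { isEquivalence = record
              { refl  = λ {i} → ≡⇒≈ {i} refl
              ; sym   = λ {i} {j} i≈j → subst (+ v ∣_) (neg i j) (∣m⇒∣-m i≈j)
              ; trans = λ {i} {j} {k} i≈j j≈k →
                  subst (+ v ∣_) (telescope i j k) (∣m∣n⇒∣m+n i≈j j≈k)
              }
            ; ∙-cong = λ {i} {j} {k} {l} i≈j k≈l →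
                subst (+ v ∣_) (interchange i j k l) (∣m∣n⇒∣m+n i≈j k≈l)
            }
          ; assoc = λ i j k → ≡⇒≈ (+-assoc i j k)
          }
        ; identity = (λ i → ≡⇒≈ (+-identityˡ i)) , (λ i → ≡⇒≈ (+-identityʳ i))
        }
      ; inverse = (λ i → ≡⇒≈ (+-inverseˡ i)) , (λ i → ≡⇒≈ (+-inverseʳ i))
      ; ⁻¹-cong = λ {i} {j} i≈j → subst (+ v ∣_) (neg-cong i j) (∣m⇒∣-m i≈j)
      }
    ; comm = λ i j → ≡⇒≈ (+-comm i j)
    }
  }
  where
  _≈_ : ℤ → ℤ → Set
  i ≈ j = + v ∣ i - j

  ≡⇒≈ : ∀ {i j} → i ≡ j → i ≈ j
  ≡⇒≈ {i} refl = divides 0ℤ (+-inverseʳ i)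

  neg : ∀ i j → - (i - j) ≡ j - i
  neg = solve-∀

  neg-cong : ∀ i j → - (i - j) ≡ - i - - j
  neg-cong = solve-∀

  telescope : ∀ i j k → (i - j) + (j - k) ≡ i - k
  telescope = solve-∀

  interchange : ∀ i j k l → (i - j) + (k - l) ≡ (i + k) - (j + l)
  interchange = solve-∀

ℤ-mod-group : ℕ → Group 0ℓ 0ℓ
ℤ-mod-group v = AbelianGroup.group (ℤ-mod v)

SmallestPrimeDivisor : ℕ → ℕ → Set
SmallestPrimeDivisor p v =
  Prime p × p ℕ.∣ v × (∀ q → Prime q → q ℕ.∣ v → p ℕ.≤ q)

-- Take E = {(0, d, 2d, …, (p - 1)d) ∣ d ∈ D}.  The differences of coordinates
-- x and y form (x - y)D.  As 0 < ∣x - y∣ < p and v has no prime divisor below p,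
-- x - y is a unit modulo v, so (x - y)D is the image of D under an automorphism
-- of ℤ_v and hence again a difference set; D itself is recovered from
-- coordinates 1 and 0.

{-# OPTIONS --safe #-}
module Submission where

open import Defs
open import Level using (0ℓ; Level; _⊔_)
open import Data.Nat.Base using (ℕ; _≤_)
open import Data.Integer.Base using (ℤ)
open import Relation.Unary using (Pred)

open import Algebra.Bundles using (Group)
open import Algebra.Morphism.Structures using (IsGroupIsomorphism)
import Algebra.Properties.Group as GroupProperties
open import Data.Empty using (⊥-elim)
open import Data.Fin.Base as Fin using (Fin; toℕ)
open import Data.Fin.Properties using (toℕ<n)
open import Data.Integer.Base using (+_; _+_; _-_; -_; _*_; _⊖_; 1ℤ)
import Data.Integer.Properties as ℤ
open import Data.Integer.Divisibility.Signed
  using (_∣_; divides; ∣m∣n⇒∣m-n; ∣n⇒∣m*n; ∣m⇒∣m*n)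
open import Data.Integer.Tactic.RingSolver using (solve-∀)
open import Data.List.Base using (map; []; _∷_)
open import Data.List.Membership.Setoid.Properties using (∈-map⁺; ∈-map⁻; ∈-resp-≈)
open import Data.List.Properties using (length-map)
open import Data.List.Relation.Unary.All using (_∷_)
import Data.List.Relation.Unary.Unique.Setoid.Properties as Unique
import Data.Nat.Base as ℕ
open import Data.Nat.Coprimality using (Coprime; coprime-Bézout)
import Data.Nat.Divisibility as ℕ
open import Data.Nat.GCD using (module Bézout)
open import Data.Nat.ListAction using (product)
open import Data.Nat.Primality
  using (Prime; _Rough_; ¬prime[0]; ¬prime[1])
open import Data.Nat.Primality.Factorisation using (factorise)
import Data.Nat.Properties as ℕ
open import Data.Product.Base using (∃-syntax; _×_; _,_)
open import Data.Product.Relation.Binary.Pointwise.NonDependent using (×-setoid)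
open import Data.Vec.Functional using (Vector)
open import Data.Vec.Functional.Relation.Binary.Equality.Setoid using (≋-setoid)
open import Function.Base using (id; _∘_)
open import Function.Bundles using (_⇔_; mk⇔; Equivalence)
open import Function.Definitions using (Congruent; Injective)
open import Relation.Binary.Bundles using (Setoid)
open import Relation.Binary.Definitions using (_Respects_)
open import Relation.Binary.PropositionalEquality
  using (_≡_; refl; sym; trans; cong; cong₂; subst; module ≡-Reasoning)

private
  variable
    a b ℓ ℓ′ p q : Level

open Equivalence using (to; from)

-- Cardinalities of subsets of a setoid

module _ (S : Setoid a ℓ) where

  open Setoid S using (_≈_) renaming (sym to ≈-sym)

  -- Needed to recover `D` at the end: an element of `Differences` is only congruent to an element
  -- of `D`, so membership in `D` must pass along the congruence.
  HasSize-respects : ∀ {P : Pred (Setoid.Carrier S) p} {k} → HasSize S P k → P Respects _≈_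
  HasSize-respects (_ , _ , _ , P⇔) x≈y = from (P⇔ _) ∘ ∈-resp-≈ S x≈y ∘ to (P⇔ _)

module _ (S : Setoid a ℓ) (T : Setoid b ℓ′) where

  private
    module S = Setoid S
    module T = Setoid T

  -- A relation between `P` and `Q` rather than a constructed image, so that `Q` can be a predicate
  -- defined independently, such as `Differences` or `Representations`.
  IsImage : (S.Carrier → T.Carrier) → Pred S.Carrier p → Pred T.Carrier q →
            Set (a ⊔ b ⊔ ℓ′ ⊔ p ⊔ q)
  IsImage f P Q = ∀ y → Q y ⇔ (∃[ x ] P x × y T.≈ f x)

  -- The list enumerating `P` is mapped through `f`: injectivity keeps its entries distinct, and
  -- congruence carries membership across.
  HasSize-image : ∀ {f} {P : Pred S.Carrier p} {Q : Pred T.Carrier q} {k} →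
                  Congruent S._≈_ T._≈_ f → Injective S._≈_ T._≈_ f →
                  IsImage f P Q → HasSize S P k → HasSize T Q k
  HasSize-image {f = f} f-cong f-inj Q⇔ (xs , unique , length≡k , P⇔) =
    map f xs , Unique.map⁺ S T f-inj unique , trans (length-map f xs) length≡k ,
    λ y → mk⇔
      (λ Qy → let (x , Px , y≈fx) = to (Q⇔ y) Qy in
         ∈-resp-≈ T (T.sym y≈fx) (∈-map⁺ S T f-cong (to (P⇔ x) Px)))
      (λ y∈ → let (x , x∈ , y≈fx) = ∈-map⁻ S T y∈ in
         from (Q⇔ y) (x , from (P⇔ x) x∈ , y≈fx))

-- Difference sets under group isomorphisms

module _ (G : Group a ℓ) (H : Group b ℓ′) where

  private
    module G = Group G
    module H = Group H

  -- Applying `f` to both entries of a pair matches the representations of `g` in `D` with those of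
  -- `f g` in `D′`, because `f` preserves subtraction and is injective.
  isDifferenceSet-image :
    ∀ {f v k λ′} {D : Pred G.Carrier p} {D′ : Pred H.Carrier q} →
    IsGroupIsomorphism G.rawGroup H.rawGroup f →
    IsImage G.setoid H.setoid f D D′ →
    IsDifferenceSet G v k λ′ D → IsDifferenceSet H v k λ′ D′
  isDifferenceSet-image {f = f} {D = D} {D′ = D′} iso D′⇔ ds = record
    { order = HasSize-image G.setoid H.setoid ⟦⟧-cong injective
        (λ y → mk⇔ (λ _ → let (x , fx≈y) = surjective y in x , _ , H.sym (fx≈y G.refl)) _)
        order
    ; size = HasSize-image G.setoid H.setoid ⟦⟧-cong injective D′⇔ size
    -- Write `h` as `f g`. Since `f` sends identity to identity, `g` is not the identity either, so
    -- `λ′` counts its representations.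
    ; representations = λ h h≉ε →
        let (g , f≈h) = surjective h
            fg≈h = f≈h G.refl
        in HasSize-image (×-setoid G.setoid G.setoid) (×-setoid H.setoid H.setoid)
             (λ (x≈ , y≈) → ⟦⟧-cong x≈ , ⟦⟧-cong y≈)
             (λ (x≈ , y≈) → injective x≈ , injective y≈)
             (representations-image fg≈h)
             (representations g λ g≈ε →
               h≉ε (H.trans (H.sym fg≈h) (H.trans (⟦⟧-cong g≈ε) ε-homo)))
    }
    where
    open IsGroupIsomorphism iso
    open IsDifferenceSet ds

    //-homo : ∀ x y → f (x G.// y) H.≈ f x H.// f y
    //-homo x y = H.trans (∙-homo x (y G.⁻¹)) (H.∙-congˡ (⁻¹-homo y))

    representations-image : ∀ {g h} → f g H.≈ h →
      IsImage (×-setoid G.setoid G.setoid) (×-setoid H.setoid H.setoid)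
              (λ (x , y) → f x , f y)
              (Representations G D g) (Representations H D′ h)
    representations-image fg≈h (x′ , y′) = mk⇔
      (λ (D′x′ , D′y′ , x′//y′≈h) →
        let (x , Dx , x′≈fx) = to (D′⇔ x′) D′x′
            (y , Dy , y′≈fy) = to (D′⇔ y′) D′y′
        in (x , y) ,
           (Dx , Dy , injective
             (H.trans (//-homo x y)
             (H.trans (GroupProperties.//-cong₂ H (H.sym x′≈fx) (H.sym y′≈fy))
             (H.trans x′//y′≈h (H.sym fg≈h))))) ,
           (x′≈fx , y′≈fy))
      (λ ((x , y) , (Dx , Dy , x//y≈g) , (x′≈fx , y′≈fy)) →
        from (D′⇔ x′) (x , Dx , x′≈fx) , from (D′⇔ y′) (y , Dy , y′≈fy) ,
        H.trans (GroupProperties.//-cong₂ H x′≈fx y′≈fy)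
        (H.trans (H.sym (//-homo x y))
        (H.trans (⟦⟧-cong x//y≈g) fg≈h)))

-- Units modulo `v` and the family of multiples

module _ (v : ℕ) where

  private
    module ℤᵥ = Group (ℤ-mod-group v)

  *-congˡ : ∀ u → Congruent ℤᵥ._≈_ ℤᵥ._≈_ (u *_)
  *-congˡ u {x} {y} x≈y = subst (+ v ∣_) (distrib u x y) (∣n⇒∣m*n u x≈y)
    where
    distrib : ∀ u x y → u * (x - y) ≡ u * x - u * y
    distrib = solve-∀

  *-isGroupIsomorphism : ∀ u w → u * w ℤᵥ.≈ 1ℤ →
                         IsGroupIsomorphism ℤᵥ.rawGroup ℤᵥ.rawGroup (u *_)
  *-isGroupIsomorphism u w uw≈1 = record
    { isGroupMonomorphism = record
      { isGroupHomomorphism = record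
        { isMonoidHomomorphism = record
          { isMagmaHomomorphism = record
            { isRelHomomorphism = record { cong = λ {x} {y} → *-congˡ u {x} {y} }
            ; homo = λ x y → ℤᵥ.reflexive (ℤ.*-distribˡ-+ u x y)
            }
          ; ε-homo = ℤᵥ.reflexive (ℤ.*-zeroʳ u)
          }
        ; ⁻¹-homo = λ x → ℤᵥ.reflexive (sym (ℤ.neg-distribʳ-* u x))
        }
      -- Modulo `v`, `w` times `u * x - u * y` is `x - y`; the error term `(u * w - 1ℤ) * (x - y)`
      -- is itself divisible by `v`.
      ; injective = λ {x} {y} ux≈uy → subst (+ v ∣_) (cancel u w x y)
          (∣m∣n⇒∣m-n (∣n⇒∣m*n w ux≈uy) (∣m⇒∣m*n (x - y) uw≈1))
      }
    ; surjective = λ y → w * y , λ {z} z≈wy →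
        ℤᵥ.trans {u * z} {u * (w * y)} {y} (*-congˡ u {z} {w * y} z≈wy)
          (subst (+ v ∣_) (section u w y) (∣m⇒∣m*n y uw≈1))
    }
    where
    cancel : ∀ u w x y → w * (u * x - u * y) - (u * w - 1ℤ) * (x - y) ≡ x - y
    cancel = solve-∀

    section : ∀ u w y → (u * w - 1ℤ) * y ≡ u * (w * y) - y
    section = solve-∀

  -- Bézout over the naturals comes in two sign patterns. The coefficient `x` of `n` is the inverse
  -- in the first, and `- + x` in the second.
  coprime⇒unit : ∀ {n} → Coprime n v → ∃[ w ] + n * w ℤᵥ.≈ 1ℤ
  coprime⇒unit {n} coprime with coprime-Bézout coprime
  ... | Bézout.+- x y 1+yv≡xn = + x , divides (+ y) (begin
    + n * + x - 1ℤ         ≡⟨ cong (_- 1ℤ) (ℤ.*-comm (+ n) (+ x)) ⟩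
    + x * + n - 1ℤ         ≡⟨ cong (_- 1ℤ) (ℤ.pos-* x n) ⟨
    + (x ℕ.* n) - 1ℤ       ≡⟨ cong (λ m → + m - 1ℤ) 1+yv≡xn ⟨
    + (1 ℕ.+ y ℕ.* v) - 1ℤ ≡⟨ cong (_- 1ℤ) (ℤ.pos-+ 1 (y ℕ.* v)) ⟩
    1ℤ + + (y ℕ.* v) - 1ℤ  ≡⟨ drop-1 (+ (y ℕ.* v)) ⟩
    + (y ℕ.* v)            ≡⟨ ℤ.pos-* y v ⟩
    + y * + v              ∎)
    where
    open ≡-Reasoning
    drop-1 : ∀ i → 1ℤ + i - 1ℤ ≡ i
    drop-1 = solve-∀
  ... | Bézout.-+ x y 1+xn≡yv = - + x , divides (- + y) (begin
    + n * - + x - 1ℤ       ≡⟨ collect (+ n) (+ x) ⟩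
    - (1ℤ + + x * + n)     ≡⟨ cong (λ i → - (1ℤ + i)) (ℤ.pos-* x n) ⟨
    - (1ℤ + + (x ℕ.* n))   ≡⟨ cong -_ (ℤ.pos-+ 1 (x ℕ.* n)) ⟨
    - + (1 ℕ.+ x ℕ.* n)    ≡⟨ cong (λ m → - + m) 1+xn≡yv ⟩
    - + (y ℕ.* v)          ≡⟨ cong -_ (ℤ.pos-* y v) ⟩
    - (+ y * + v)          ≡⟨ ℤ.neg-distribˡ-* (+ y) (+ v) ⟩
    - + y * + v            ∎)
    where
    open ≡-Reasoning
    collect : ∀ i j → i * - j - 1ℤ ≡ - (1ℤ + j * i)
    collect = solve-∀

  multiples : ∀ n → ℤ → Vector ℤ n
  multiples n d i = + toℕ i * d

  -- Tuples are taken up to coordinatewise congruence, since a predicate with a size must respect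
  -- the setoid equality.
  Multiples : ∀ n → Pred ℤ p → Pred (Vector ℤ n) p
  Multiples n D e = ∃[ d ] D d × (∀ i → e i ℤᵥ.≈ multiples n d i)

  -- By distributivity, subtracting coordinates multiplies `d` by the integer `x - y`. The order of
  -- `x` and `y` is left free: the pairs with `x < y` give the difference sets, and the pair 1, 0
  -- gives back `D`.
  differences-image : ∀ {n} {D : Pred ℤ p} (x y : Fin n) →
    IsImage ℤᵥ.setoid ℤᵥ.setoid ((+ toℕ x - + toℕ y) *_)
            D (Differences (ℤ-mod-group v) (Multiples n D) x y)
  differences-image {n = n} x y g = mk⇔
    (λ (e , (d , Dd , e≈) , g≈) → d , Dd ,
      ℤᵥ.trans {g} {e x - e y} {(+ toℕ x - + toℕ y) * d} g≈
        (subst (e x - e y ℤᵥ.≈_) (sym (distrib (+ toℕ x) (+ toℕ y) d))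
          (GroupProperties.//-cong₂ (ℤ-mod-group v)
            {e x} {multiples n d x} {e y} {multiples n d y} (e≈ x) (e≈ y))))
    (λ (d , Dd , g≈) → multiples n d , (d , Dd , λ i → ℤᵥ.refl {multiples n d i}) ,
      subst (g ℤᵥ.≈_) (distrib (+ toℕ x) (+ toℕ y) d) g≈)
    where
    distrib : ∀ i j d → (i - j) * d ≡ i * d - j * d
    distrib = solve-∀

-- Rough numbers and invertible index differences

prime-divisor : ∀ n → .{{ℕ.NonTrivial n}} → ∃[ q ] Prime q × q ℕ.∣ n
prime-divisor n@(ℕ.2+ _) with factorise n
... | record { factors = [] ; isFactorisation = () }
... | record { factors = q ∷ qs ; isFactorisation = n≡ ; factorsPrime = q-prime ∷ _ } =
  q , q-prime , subst (q ℕ.∣_) (sym n≡) (ℕ.m∣m*n (product qs))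

-- A nontrivial divisor of `v` below `p` would have a prime factor, again below `p` and dividing
-- `v`.
smallestPrimeDivisor⇒rough : ∀ {p v} → SmallestPrimeDivisor p v → p Rough v
smallestPrimeDivisor⇒rough (_ , _ , p≤) (ℕ.hasNonTrivialDivisor {divisor = d} d<p d∣v) =
  let (q , q-prime , q∣d) = prime-divisor d in
  ℕ.<⇒≱ d<p (ℕ.≤-trans (p≤ q q-prime (ℕ.∣-trans q∣d d∣v))
                         (ℕ.∣⇒≤ {{ℕ.nonTrivial⇒nonZero d}} q∣d))

-- A common divisor greater than 1 is at most `n`, hence below `m`, and divides `o`, contrary to
-- roughness.
rough∧<⇒coprime : ∀ {m n o} → .{{ℕ.NonZero n}} → m Rough o → n ℕ.< m → Coprime n o
rough∧<⇒coprime _ _ {0} (0∣n , _) = ⊥-elim (ℕ.≢-nonZero⁻¹ _ (ℕ.0∣⇒≡0 0∣n))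
rough∧<⇒coprime _ _ {1} _ = refl
rough∧<⇒coprime rough n<m {ℕ.2+ _} (d∣n , d∣o) =
  ⊥-elim (rough (ℕ.hasNonTrivialDivisor (ℕ.≤-<-trans (ℕ.∣⇒≤ d∣n) n<m) d∣o))

rough⇒difference-unit : ∀ {n v} → n Rough v → {x y : Fin n} → x Fin.< y →
  ∃[ w ] + v ∣ (+ toℕ x - + toℕ y) * w - 1ℤ
rough⇒difference-unit {n} {v} rough {x} {y} x<y =
  let m = toℕ y ℕ.∸ toℕ x
      (w , mw≈1) = coprime⇒unit v {m} (rough∧<⇒coprime
        {{ℕ.>-nonZero (ℕ.m<n⇒0<n∸m x<y)}} rough
        (ℕ.≤-<-trans (ℕ.m∸n≤m (toℕ y) (toℕ x)) (toℕ<n y)))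
  -- Coprimality concerns naturals, so `w` inverts the positive number `y - x`; negating it inverts
  -- `x - y`.
  in - w , subst (+ v ∣_) (cong (_- 1ℤ) (begin
    + m * w                          ≡⟨ cong (_* w) (ℤ.⊖-≥ (ℕ.<⇒≤ x<y)) ⟨
    (toℕ y ⊖ toℕ x) * w              ≡⟨ cong (_* w) (ℤ.m-n≡m⊖n (toℕ y) (toℕ x)) ⟨
    (+ toℕ y - + toℕ x) * w          ≡⟨ flip-signs (+ toℕ x) (+ toℕ y) w ⟩
    (+ toℕ x - + toℕ y) * - w        ∎)) mw≈1
  where
  open ≡-Reasoning
  flip-signs : ∀ i j w → (j - i) * w ≡ (i - j) * - w
  flip-signs = solve-∀

-- The form `2+ n` of the dimension guarantees coordinates 0 and 1, which hold 0 and `d`.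
rough⇒extendsToDimension : ∀ {n v k λ′} {D : Pred ℤ 0ℓ} → ℕ.2+ n Rough v →
  IsDifferenceSet (ℤ-mod-group v) v k λ′ D →
  ExtendsToDimension (ℤ-mod-group v) (ℕ.2+ n) v k λ′ D
rough⇒extendsToDimension {n} {v} {D = D} rough ds =
  Multiples v (ℕ.2+ n) D ,
  record
    { order = order
    ; size = HasSize-image setoid (≋-setoid setoid (ℕ.2+ n))
        (λ {x} {y} x≈y i → *-congˡ v (+ toℕ i) {x} {y} x≈y)
        -- Coordinate 1 of the tuple is `1ℤ * d`, so the tuple determines `d` modulo `v`.
        (λ {x} {y} eq → subst (+ v ∣_) (cong₂ _-_ (ℤ.*-identityˡ x) (ℤ.*-identityˡ y))
                              (eq (Fin.suc Fin.zero)))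
        (λ _ → mk⇔ id id)
        size
    ; differences = λ x y x<y → isDifferenceSet-image (ℤ-mod-group v) (ℤ-mod-group v)
        (let (w , uw≈1) = rough⇒difference-unit rough x<y in
          *-isGroupIsomorphism v (+ toℕ x - + toℕ y) w uw≈1)
        (differences-image v x y) ds
    } ,
  Fin.suc Fin.zero , Fin.zero , (λ ()) ,
  (λ {g} Dg → from (D₁₀⇔ g) (g , Dg , reflexive (sym (ℤ.*-identityˡ g)))) ,
  (λ {g} g∈ → let (d , Dd , g≈1d) = to (D₁₀⇔ g) g∈ in
     HasSize-respects setoid size {d} {g}
       (≈-sym {g} {d} (subst (g ≈_) (ℤ.*-identityˡ d) g≈1d)) Dd)
  where
  open Group (ℤ-mod-group v) using (_≈_; setoid; reflexive) renaming (sym to ≈-sym)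
  open IsDifferenceSet ds
  D₁₀⇔ = differences-image v {n = ℕ.2+ n} {D = D} (Fin.suc Fin.zero) Fin.zero

corollary4p8 : (v p : ℕ) → 2 ≤ v → SmallestPrimeDivisor p v →
    (k λ′ : ℕ) (D : Pred ℤ 0ℓ) →
    IsDifferenceSet (ℤ-mod-group v) v k λ′ D →
    ExtendsToDimension (ℤ-mod-group v) p v k λ′ D
-- Primality rules out 0 and 1, which leaves a dimension with at least two coordinates.
corollary4p8 v 0 _ (p-prime , _) _ _ _ _ = ⊥-elim (¬prime[0] p-prime)
corollary4p8 v 1 _ (p-prime , _) _ _ _ _ = ⊥-elim (¬prime[1] p-prime)
corollary4p8 v (ℕ.2+ _) _ spd _ _ _ ds =
  rough⇒extendsToDimension (smallestPrimeDivisor⇒rough spd) ds
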